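{- For every $K_3N$ $n=pqr$, $$p\le\left\lceil\sqrt[3]{n}-\frac{4\sqrt3}{9}\sqrt[6]{n}\right\rceil .$$
   Context: A $K_3N$ (Korselt number with three factors) is an integer $n$ together with a factorisation $n=pqr$, where $1<p<q<r$ are odd integers (not necessarily prime) such that each of $p-1,\ q-1,\ r-1$ divides $n-1$, and such that $E:=\dfrac{pq-1}{r-1}$ (which is an integer by the divisibility condition) satisfies $E\ge 2$. -}

module Defs where

open import Data.Empty using (⊥-elim)
open import Data.Integer as ℤ using (ℤ; +_)
import Data.Integer.Properties as ℤ
open import Data.Integer.Tactic.RingSolver using () renaming (solve-∀ to solveℤ)
open import Data.Nat as ℕ using (ℕ; zero; suc; NonZero; s≤s; z≤n)
import Data.Nat.Properties as ℕ
open import Data.Nat.Divisibility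
  using (_∣_; _∤_; quotient; n∣m*n; ∣m+n∣m⇒∣n)
open import Data.Nat.Tactic.RingSolver using () renaming (solve-∀ to solveℕ)
open import Data.Product using (∃; ∃-syntax; _×_; _,_; proj₁; proj₂)
open import Data.Rational as ℚ using (ℚ; 0ℚ; 1ℚ; mkℚ; _/_; _+_; _-_; _*_; ∣_∣)
import Data.Rational.Properties as ℚ
open import Algebra.Properties.Group ℚ.+-0-group using ()
  renaming (⁻¹-involutive to neg-involutive)
import Data.Rational.Unnormalised as ℚᵘ
import Data.Rational.Unnormalised.Properties as ℚᵘ
open import Data.Rational.Solver using (module +-*-Solver)
open import Data.Sum using ([_,_]′)
open import Relation.Binary.PropositionalEquality
open import Relation.Nullary using (¬_; yes; no)

private
  -- abc - 1 = ab (c - 1) + (ab - 1)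
  c-1∣ab-1 : ∀ {n a b c} → n ≡ a ℕ.* b ℕ.* c → 1 ℕ.< a → a ℕ.< b → b ℕ.< c →
             (c ℕ.∸ 1) ∣ (n ℕ.∸ 1) → (c ℕ.∸ 1) ∣ (a ℕ.* b ℕ.∸ 1)
  c-1∣ab-1 {n} {a} {b} {c} n≡abc 1<a a<b b<c c-1∣n-1 =
    ∣m+n∣m⇒∣n (subst ((c ℕ.∸ 1) ∣_) splits c-1∣n-1) (n∣m*n (a ℕ.* b))
    where
    1<b : 1 ℕ.< b
    1<b = ℕ.<-trans 1<a a<b
    identity : ∀ x y → 1 ℕ.≤ x → 1 ℕ.≤ y →
               x ℕ.* y ℕ.∸ 1 ≡ x ℕ.* (y ℕ.∸ 1) ℕ.+ (x ℕ.∸ 1)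
    identity (suc x) (suc y) _ _ = ring x y
      where
      ring : ∀ x y → y ℕ.+ x ℕ.* suc y ≡ y ℕ.+ x ℕ.* y ℕ.+ x
      ring = solveℕ
    splits : n ℕ.∸ 1 ≡ a ℕ.* b ℕ.* (c ℕ.∸ 1) ℕ.+ (a ℕ.* b ℕ.∸ 1)
    splits = trans (cong (ℕ._∸ 1) n≡abc) (identity (a ℕ.* b) c
      (ℕ.*-mono-≤ (ℕ.<⇒≤ 1<a) (ℕ.<⇒≤ 1<b)) (ℕ.<⇒≤ (ℕ.<-trans 1<b b<c)))

-- All of n, p, q, r exceed 1, so they are taken in ℕ and ∸ 1 never truncates.
record IsK₃N (n p q r : ℕ) : Set where
  field
    n≡pqr : n ≡ p ℕ.* q ℕ.* r
    1<p   : 1 ℕ.< p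
    p<q   : p ℕ.< q
    q<r   : q ℕ.< r
    p-odd : 2 ∤ p
    q-odd : 2 ∤ q
    r-odd : 2 ∤ r
    p-1∣n-1 : (p ℕ.∸ 1) ∣ (n ℕ.∸ 1)
    q-1∣n-1 : (q ℕ.∸ 1) ∣ (n ℕ.∸ 1)
    r-1∣n-1 : (r ℕ.∸ 1) ∣ (n ℕ.∸ 1)

  r-1∣pq-1 : (r ℕ.∸ 1) ∣ (p ℕ.* q ℕ.∸ 1)
  r-1∣pq-1 = c-1∣ab-1 n≡pqr 1<p p<q q<r r-1∣n-1

  -- E = (pq - 1) / (r - 1), an exact division
  E : ℕ
  E = quotient r-1∣pq-1

  field
    2≤E : 2 ℕ.≤ E

------------------------------------------------------------------------
-- Real numbers as Cauchy sequences of rationals.  Equality of reals is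
-- not used: all relations below depend only on the limits.

IsCauchy : (ℕ → ℚ) → Set
IsCauchy x = ∀ ε → 0ℚ ℚ.< ε →
  ∃[ N ] ∀ m n → N ℕ.≤ m → N ℕ.≤ n → ∣ x m - x n ∣ ℚ.< ε

record ℝ : Set where
  constructor _,_
  field
    seq    : ℕ → ℚ
    cauchy : IsCauchy seq

open ℝ public

infix 4 _<ᴿ_ _≤ᴿ_

_<ᴿ_ : ℝ → ℝ → Set
x <ᴿ y = ∃[ ε ] 0ℚ ℚ.< ε × ∃[ N ] ∀ n → N ℕ.≤ n → seq x n + ε ℚ.≤ seq y n

_≤ᴿ_ : ℝ → ℝ → Set
x ≤ᴿ y = ¬ (y <ᴿ x)

fromℚ : ℚ → ℝ
fromℚ a = (λ _ → a) , λ ε 0<ε → 0 , λ _ _ _ _ →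
  subst (ℚ._< ε) (sym (cong ∣_∣ (ℚ.+-inverseʳ a))) 0<ε

fromℤ : ℤ → ℝ
fromℤ c = fromℚ (c / 1)

private
  module _ where
    open +-*-Solver

    difference-regroup : ∀ a b c d → (a - b) - (c - d) ≡ (a - c) - (b - d)
    difference-regroup = solve 4 (λ a b c d →
      ((a :- b) :- (c :- d)) := ((a :- c) :- (b :- d))) refl

    product-regroup : ∀ a b c d → a * (b - d) + d * (a - c) ≡ a * b - c * d
    product-regroup = solve 4 (λ a b c d →
      (a :* (b :- d) :+ d :* (a :- c)) := (a :* b :- c :* d)) refl

    split-rearrange : ∀ a b e i → a * (e * i) + b * (e * i) ≡ e * ((a + b) * i)
    split-rearrange = solve 4 (λ a b e i →
      (a :* (e :* i) :+ b :* (e :* i)) := (e :* ((a :+ b) :* i))) refl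

    b+[a-b]≡a : ∀ a b → b + (a - b) ≡ a
    b+[a-b]≡a = solve 2 (λ a b → (b :+ (a :- b)) := a) refl

    [a+b]-a≡b : ∀ a b → (a + b) - a ≡ b
    [a+b]-a≡b = solve 2 (λ a b → ((a :+ b) :- a) := b) refl

    -[a-b]≡b-a : ∀ a b → ℚ.- (a - b) ≡ b - a
    -[a-b]≡b-a = solve 2 (λ a b → (:- (a :- b)) := (b :- a)) refl

    -[a+b]+b≡-a : ∀ a b → ℚ.- (a + b) + b ≡ ℚ.- a
    -[a+b]+b≡-a = solve 2 (λ a b → (:- (a :+ b) :+ b) := (:- a)) refl

  0<1 : 0ℚ ℚ.< 1ℚ
  0<1 = ℚ.positive⁻¹ 1ℚ

  0<+ : ∀ {a b} → 0ℚ ℚ.≤ a → 0ℚ ℚ.< b → 0ℚ ℚ.< a + b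
  0<+ {a} {b} 0≤a 0<b =
    subst (ℚ._< a + b) (ℚ.+-identityˡ 0ℚ) (ℚ.+-mono-≤-< 0≤a 0<b)

  split : ∀ {A B ε} → 0ℚ ℚ.< A → 0ℚ ℚ.< B → 0ℚ ℚ.< ε →
          ∃[ δ ] 0ℚ ℚ.< δ × A * δ + B * δ ≡ ε
  split {A} {B} {ε} 0<A 0<B 0<ε =
    ε * i , ℚ.positive⁻¹ (ε * i) {{ℚ.pos*pos⇒pos ε {{ε>0}} i {{i>0}}}} ,
    trans (split-rearrange A B ε i)
      (trans (cong (ε *_) (ℚ.*-inverseʳ (A + B) {{A+B≢0}})) (ℚ.*-identityʳ ε))
    where
    ε>0 : ℚ.Positive ε
    ε>0 = ℚ.positive 0<ε
    A+B>0 : ℚ.Positive (A + B)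
    A+B>0 = ℚ.positive (0<+ (ℚ.<⇒≤ 0<A) 0<B)
    A+B≢0 : ℚ.NonZero (A + B)
    A+B≢0 = ℚ.pos⇒nonZero (A + B) {{A+B>0}}
    i : ℚ
    i = (ℚ.1/ (A + B)) {{A+B≢0}}
    i>0 : ℚ.Positive i
    i>0 = ℚ.1/pos⇒pos (A + B) {{A+B>0}}

  difference-close : ∀ {δ₁ δ₂} a b c d → ∣ a - c ∣ ℚ.< δ₁ → ∣ b - d ∣ ℚ.< δ₂ →
                     ∣ (a - b) - (c - d) ∣ ℚ.< δ₁ + δ₂
  difference-close a b c d a~c b~d = ℚ.≤-<-trans
    (subst (λ z → ∣ z ∣ ℚ.≤ ∣ a - c ∣ + ∣ b - d ∣)
      (sym (difference-regroup a b c d)) (ℚ.∣p-q∣≤∣p∣+∣q∣ (a - c) (b - d)))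
    (ℚ.+-mono-< a~c b~d)

  scale : ∀ {C δ} a b → 0ℚ ℚ.< C → ∣ a ∣ ℚ.≤ C → ∣ b ∣ ℚ.< δ →
          ∣ a * b ∣ ℚ.< C * δ
  scale {C} {δ} a b 0<C a≤C b<δ =
    subst (ℚ._< C * δ) (sym (ℚ.∣p*q∣≡∣p∣*∣q∣ a b)) (ℚ.≤-<-trans
      (ℚ.*-monoʳ-≤-nonNeg ∣ b ∣ {{ℚ.∣-∣-nonNeg b}} a≤C)
      (ℚ.*-monoʳ-<-pos C {{ℚ.positive 0<C}} b<δ))

  product-close : ∀ {A B δ} a b c d → 0ℚ ℚ.< A → 0ℚ ℚ.< B →
    ∣ a ∣ ℚ.≤ A → ∣ d ∣ ℚ.≤ B → ∣ a - c ∣ ℚ.< δ → ∣ b - d ∣ ℚ.< δ →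
    ∣ a * b - c * d ∣ ℚ.< A * δ + B * δ
  product-close {A} {B} a b c d 0<A 0<B a≤A d≤B a~c b~d = ℚ.≤-<-trans
    (subst (λ z → ∣ z ∣ ℚ.≤ ∣ a * (b - d) ∣ + ∣ d * (a - c) ∣)
      (product-regroup a b c d) (ℚ.∣p+q∣≤∣p∣+∣q∣ (a * (b - d)) (d * (a - c))))
    (ℚ.+-mono-< (scale {A} a (b - d) 0<A a≤A b~d) (scale {B} d (a - c) 0<B d≤B a~c))

  bounded-by : ∀ a b → ∣ a - b ∣ ℚ.< 1ℚ → ∣ a ∣ ℚ.≤ ∣ b ∣ + 1ℚ
  bounded-by a b a~b = ℚ.≤-trans
    (subst (λ z → ∣ z ∣ ℚ.≤ ∣ b ∣ + ∣ a - b ∣) (b+[a-b]≡a a b) (ℚ.∣p+q∣≤∣p∣+∣q∣ b (a - b)))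
    (ℚ.+-monoʳ-≤ ∣ b ∣ (ℚ.<⇒≤ a~b))

  eventually-bounded : ∀ {x} → IsCauchy x →
    ∃[ A ] 0ℚ ℚ.< A × ∃[ N ] ∀ n → N ℕ.≤ n → ∣ x n ∣ ℚ.≤ A
  eventually-bounded {x} x-cauchy =
    let N , x~ = x-cauchy 1ℚ 0<1 in
    ∣ x N ∣ + 1ℚ , 0<+ (ℚ.0≤∣p∣ (x N)) 0<1 , N ,
    λ n N≤n → bounded-by (x n) (x N) (x~ n N N≤n ℕ.≤-refl)

  difference-cauchy : ∀ {x y} → IsCauchy x → IsCauchy y → IsCauchy (λ n → x n - y n)
  difference-cauchy {x} {y} x-cauchy y-cauchy ε 0<ε =
    let δ , 0<δ , δ+δ≡ε = split {1ℚ} {1ℚ} 0<1 0<1 0<ε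
        N , x~ = x-cauchy δ 0<δ
        M , y~ = y-cauchy δ 0<δ
    in N ℕ.⊔ M , λ m n N≤m N≤n →
    subst (∣ (x m - y m) - (x n - y n) ∣ ℚ.<_)
      (trans (sym (cong₂ _+_ (ℚ.*-identityˡ δ) (ℚ.*-identityˡ δ))) δ+δ≡ε)
      (difference-close (x m) (y m) (x n) (y n)
        (x~ m n (ℕ.m⊔n≤o⇒m≤o N M N≤m) (ℕ.m⊔n≤o⇒m≤o N M N≤n))
        (y~ m n (ℕ.m⊔n≤o⇒n≤o N M N≤m) (ℕ.m⊔n≤o⇒n≤o N M N≤n)))

  product-cauchy : ∀ {x y} → IsCauchy x → IsCauchy y → IsCauchy (λ n → x n * y n)
  product-cauchy {x} {y} x-cauchy y-cauchy ε 0<ε =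
    let A , 0<A , N₁ , x≤A = eventually-bounded {x} x-cauchy
        B , 0<B , N₂ , y≤B = eventually-bounded {y} y-cauchy
        δ , 0<δ , split≡ε = split {A} {B} 0<A 0<B 0<ε
        M₁ , x~ = x-cauchy δ 0<δ
        M₂ , y~ = y-cauchy δ 0<δ
        N = N₁ ℕ.⊔ N₂
        M = M₁ ℕ.⊔ M₂
    in N ℕ.⊔ M , λ m n N≤m N≤n →
    subst (∣ x m * y m - x n * y n ∣ ℚ.<_) split≡ε
      (product-close (x m) (y m) (x n) (y n) 0<A 0<B
        (x≤A m (ℕ.m⊔n≤o⇒m≤o N₁ N₂ (ℕ.m⊔n≤o⇒m≤o N M N≤m)))
        (y≤B n (ℕ.m⊔n≤o⇒n≤o N₁ N₂ (ℕ.m⊔n≤o⇒m≤o N M N≤n)))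
        (x~ m n (ℕ.m⊔n≤o⇒m≤o M₁ M₂ (ℕ.m⊔n≤o⇒n≤o N M N≤m))
                (ℕ.m⊔n≤o⇒m≤o M₁ M₂ (ℕ.m⊔n≤o⇒n≤o N M N≤n)))
        (y~ m n (ℕ.m⊔n≤o⇒n≤o M₁ M₂ (ℕ.m⊔n≤o⇒n≤o N M N≤m))
                (ℕ.m⊔n≤o⇒n≤o M₁ M₂ (ℕ.m⊔n≤o⇒n≤o N M N≤n))))

infixl 6 _-ᴿ_
infixl 7 _*ᴿ_

_-ᴿ_ : ℝ → ℝ → ℝ
seq    (x -ᴿ y) n = seq x n - seq y n
cauchy (x -ᴿ y)   = difference-cauchy {seq x} {seq y} (cauchy x) (cauchy y)

_*ᴿ_ : ℝ → ℝ → ℝ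
seq    (x *ᴿ y) n = seq x n * seq y n
cauchy (x *ᴿ y)   = product-cauchy {seq x} {seq y} (cauchy x) (cauchy y)

------------------------------------------------------------------------
-- k-th roots of natural numbers

-- ⌊root⌋ k N is the largest a with a ^ k ≤ N (for k ≥ 1)
⌊root⌋ : ℕ → ℕ → ℕ
⌊root⌋ k zero = 0
⌊root⌋ k (suc N) with suc (⌊root⌋ k N) ℕ.^ k ℕ.≤? suc N
... | yes _ = suc (⌊root⌋ k N)
... | no  _ = ⌊root⌋ k N

⌊root⌋-lower : ∀ k .{{_ : NonZero k}} N → ⌊root⌋ k N ℕ.^ k ℕ.≤ N
⌊root⌋-lower (suc k) zero = z≤n
⌊root⌋-lower k (suc N) with suc (⌊root⌋ k N) ℕ.^ k ℕ.≤? suc N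
... | yes le = le
... | no  _  = ℕ.m≤n⇒m≤1+n (⌊root⌋-lower k N)

⌊root⌋-upper : ∀ k .{{_ : NonZero k}} N → N ℕ.< suc (⌊root⌋ k N) ℕ.^ k
⌊root⌋-upper k zero = subst (0 ℕ.<_) (sym (ℕ.^-zeroˡ k)) (s≤s z≤n)
⌊root⌋-upper k (suc N) with suc (⌊root⌋ k N) ℕ.^ k ℕ.≤? suc N
... | yes _  = ℕ.≤-<-trans (⌊root⌋-upper k N) (ℕ.^-monoˡ-< k (ℕ.n<1+n _))
... | no nle = ℕ.≰⇒> nle

private
  /-mono-≤ : ∀ a b M L → a ℕ.* suc L ℕ.≤ b ℕ.* suc M →
             (+ a / suc M) ℚ.≤ (+ b / suc L)
  /-mono-≤ a b M L le = ℚ.toℚᵘ-cancel-≤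
    (ℚᵘ.≤-respˡ-≃ (ℚᵘ.≃-sym (ℚ.toℚᵘ-fromℚᵘ (ℚᵘ.mkℚᵘ (+ a) M)))
    (ℚᵘ.≤-respʳ-≃ (ℚᵘ.≃-sym (ℚ.toℚᵘ-fromℚᵘ (ℚᵘ.mkℚᵘ (+ b) L)))
    (ℚᵘ.*≤* (subst₂ ℤ._≤_ (ℤ.pos-* a (suc L)) (ℤ.pos-* b (suc M)) (ℤ.+≤+ le)))))

  /-suc : ∀ b L → (+ suc b / suc L) ≡ (+ b / suc L) + (+ 1 / suc L)
  /-suc b L = ℚ.toℚᵘ-injective (ℚᵘ.≃-trans (ℚ.toℚᵘ-fromℚᵘ (ℚᵘ.mkℚᵘ (+ suc b) L))
    (ℚᵘ.≃-trans (ℚᵘ.*≡* (ring (+ b) (+ suc L)))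
    (ℚᵘ.≃-sym (ℚᵘ.≃-trans (ℚ.toℚᵘ-homo-+ (+ b / suc L) (+ 1 / suc L))
      (ℚᵘ.+-cong (ℚ.toℚᵘ-fromℚᵘ (ℚᵘ.mkℚᵘ (+ b) L))
                 (ℚ.toℚᵘ-fromℚᵘ (ℚᵘ.mkℚᵘ (+ 1) L)))))))
    where
    ring : ∀ x y → (+ 1 ℤ.+ x) ℤ.* (y ℤ.* y) ≡ (x ℤ.* y ℤ.+ + 1 ℤ.* y) ℤ.* y
    ring = solveℤ

  archimedean : ∀ ε → 0ℚ ℚ.< ε → ∃[ N ] (+ 1 / suc N) ℚ.< ε
  archimedean ε@(mkℚ (+ suc a) d _) _ = suc d , ℚ.toℚᵘ-cancel-<
    (ℚᵘ.<-respˡ-≃ (ℚᵘ.≃-sym (ℚ.toℚᵘ-fromℚᵘ (ℚᵘ.mkℚᵘ (+ 1) (suc d))))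
      (ℚᵘ.*<* (ℤ.+<+ (s≤s (ℕ.≤-trans
        (ℕ.≤-reflexive (ℕ.+-identityʳ (suc d)))
        (ℕ.m≤m+n (suc d) (a ℕ.* suc (suc d))))))))
  archimedean (mkℚ (+ 0) d _) (ℚ.*<* (ℤ.+<+ ()))
  archimedean (mkℚ ℤ.-[1+ a ] d _) (ℚ.*<* ())

  ^-distrib-* : ∀ k a b → (a ℕ.* b) ℕ.^ k ≡ a ℕ.^ k ℕ.* b ℕ.^ k
  ^-distrib-* zero a b = refl
  ^-distrib-* (suc k) a b = trans (cong (a ℕ.* b ℕ.*_) (^-distrib-* k a b))
    (ring a b (a ℕ.^ k) (b ℕ.^ k))
    where
    ring : ∀ a b c d → a ℕ.* b ℕ.* (c ℕ.* d) ≡ a ℕ.* c ℕ.* (b ℕ.* d)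
    ring = solveℕ

-- The n-th term is a^(1/k) truncated to a multiple of 1/(n+1),
-- i.e. ⌊(n+1) a^(1/k)⌋ / (n+1).
rootSeq : ℕ → ℕ → ℕ → ℚ
rootSeq k a n = + ⌊root⌋ k (a ℕ.* suc n ℕ.^ k) / suc n

private
  shift : ∀ x y z → x ℚ.≤ y + z → x - y ℚ.≤ z
  shift x y z le = subst (x - y ℚ.≤_) ([a+b]-a≡b y z) (ℚ.+-monoˡ-≤ (ℚ.- y) le)

  ∣-∣≤ : ∀ x y z → x ℚ.≤ y + z → y ℚ.≤ x + z → ∣ x - y ∣ ℚ.≤ z
  ∣-∣≤ x y z x≤ y≤ = [
    (λ eq → subst (ℚ._≤ z) (sym eq) (shift x y z x≤)) ,
    (λ eq → subst (ℚ._≤ z) (sym (trans eq (-[a-b]≡b-a x y))) (shift y x z y≤))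
    ]′ (ℚ.∣p∣≡p∨∣p∣≡-p (x - y))

  module _ (k : ℕ) .{{_ : NonZero k}} (a : ℕ) where
    f : ℕ → ℕ
    f m = ⌊root⌋ k (a ℕ.* suc m ℕ.^ k)

    cross : ∀ m n → f m ℕ.* suc n ℕ.≤ suc (f n) ℕ.* suc m
    cross m n = ℕ.≮⇒≥ λ lt → ℕ.<-asym (ℕ.^-monoˡ-< k lt) (begin-strict
      (f m ℕ.* suc n) ℕ.^ k                ≡⟨ ^-distrib-* k (f m) (suc n) ⟩
      f m ℕ.^ k ℕ.* suc n ℕ.^ k            ≤⟨ ℕ.*-monoˡ-≤ (suc n ℕ.^ k) (⌊root⌋-lower k (a ℕ.* suc m ℕ.^ k)) ⟩
      a ℕ.* suc m ℕ.^ k ℕ.* suc n ℕ.^ k    ≡⟨ ring a (suc m ℕ.^ k) (suc n ℕ.^ k) ⟩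
      a ℕ.* suc n ℕ.^ k ℕ.* suc m ℕ.^ k
        <⟨ ℕ.*-monoˡ-< (suc m ℕ.^ k) {{ℕ.m^n≢0 (suc m) k}}
           (⌊root⌋-upper k (a ℕ.* suc n ℕ.^ k)) ⟩
      suc (f n) ℕ.^ k ℕ.* suc m ℕ.^ k      ≡⟨ ^-distrib-* k (suc (f n)) (suc m) ⟨
      (suc (f n) ℕ.* suc m) ℕ.^ k          ∎)
      where
      open ℕ.≤-Reasoning
      ring : ∀ x y z → x ℕ.* y ℕ.* z ≡ x ℕ.* z ℕ.* y
      ring = solveℕ

    near : ∀ {N} m n → N ℕ.≤ n → rootSeq k a m ℚ.≤ rootSeq k a n + (+ 1 / suc N)
    near {N} m n N≤n = ℚ.≤-trans (/-mono-≤ (f m) (suc (f n)) m n (cross m n))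
      (subst (ℚ._≤ rootSeq k a n + (+ 1 / suc N)) (sym (/-suc (f n) n))
        (ℚ.+-monoʳ-≤ (rootSeq k a n)
          (/-mono-≤ 1 1 n N (ℕ.*-monoʳ-≤ 1 (s≤s N≤n)))))

    rootSeq-cauchy : IsCauchy (rootSeq k a)
    rootSeq-cauchy ε 0<ε =
      let N , 1/N<ε = archimedean ε 0<ε in
      N , λ m n N≤m N≤n → ℚ.≤-<-trans
        (∣-∣≤ (rootSeq k a m) (rootSeq k a n) (+ 1 / suc N) (near m n N≤n) (near n m N≤m))
        1/N<ε

root : (k : ℕ) .{{_ : NonZero k}} → ℕ → ℝ
root k a = rootSeq k a , rootSeq-cauchy k a

------------------------------------------------------------------------
-- c ≡⌈ x ⌉ : c is the least integer with x ≤ c.  A relation, because a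
-- function ℝ → ℤ choosing c is not constructively definable; by the two
-- lemmas after it, c is unique and cannot fail to exist.

infix 4 _≡⌈_⌉

_≡⌈_⌉ : ℤ → ℝ → Set
c ≡⌈ x ⌉ = x ≤ᴿ fromℤ c × (∀ d → x ≤ᴿ fromℤ d → c ℤ.≤ d)

⌈⌉-unique : ∀ {x c d} → c ≡⌈ x ⌉ → d ≡⌈ x ⌉ → c ≡ d
⌈⌉-unique (x≤c , c-least) (x≤d , d-least) =
  ℤ.≤-antisym (c-least _ x≤d) (d-least _ x≤c)

private
  p≤∣p∣ : ∀ p → p ℚ.≤ ∣ p ∣
  p≤∣p∣ p = [
    (λ eq → ℚ.≤-reflexive (sym eq)) ,
    (λ eq → ℚ.≤-trans
      (subst (ℚ._≤ 0ℚ) (neg-involutive p)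
        (ℚ.neg-antimono-≤ (subst (0ℚ ℚ.≤_) eq (ℚ.0≤∣p∣ p))))
      (ℚ.0≤∣p∣ p))
    ]′ (ℚ.∣p∣≡p∨∣p∣≡-p p)

  -∣p∣≤p : ∀ p → ℚ.- ∣ p ∣ ℚ.≤ p
  -∣p∣≤p p = subst₂ (λ a b → ℚ.- a ℚ.≤ b) (ℚ.∣-p∣≡∣p∣ p) (neg-involutive p)
    (ℚ.neg-antimono-≤ (p≤∣p∣ (ℚ.- p)))

private
  module Search (x : ℝ) (A : ℚ) (N : ℕ) (x≤A : ∀ n → N ℕ.≤ n → ∣ seq x n ∣ ℚ.≤ A) where
    P : ℤ → Set
    P d = x ≤ᴿ fromℤ d

    mono : ∀ {d e} → d ℤ.≤ e → P d → P e
    mono {d} {e} d≤e Pd (ε , 0<ε , M , lt) = Pd (ε , 0<ε , M , λ n M≤n →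
      ℚ.≤-trans (ℚ.+-monoˡ-≤ ε (/1-mono d≤e)) (lt n M≤n))
      where
      /1-mono : d ℤ.≤ e → (d / 1) ℚ.≤ (e / 1)
      /1-mono d≤e = ℚ.toℚᵘ-cancel-≤
        (ℚᵘ.≤-respˡ-≃ (ℚᵘ.≃-sym (ℚ.toℚᵘ-fromℚᵘ (ℚᵘ.mkℚᵘ d 0)))
        (ℚᵘ.≤-respʳ-≃ (ℚᵘ.≃-sym (ℚ.toℚᵘ-fromℚᵘ (ℚᵘ.mkℚᵘ e 0)))
        (ℚᵘ.*≤* (ℤ.*-monoʳ-≤-nonNeg (+ 1) d≤e))))

    D : ℕ
    D = ℤ.∣ ℚ.↥ A ∣

    A≤D : A ℚ.≤ (+ D / 1)
    A≤D = ℚ.toℚᵘ-cancel-≤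
      (ℚᵘ.≤-respʳ-≃ (ℚᵘ.≃-sym (ℚ.toℚᵘ-fromℚᵘ (ℚᵘ.mkℚᵘ (+ D) 0))) (le A))
      where
      i≤∣i∣*n : ∀ i n → i ℤ.* + 1 ℤ.≤ + ℤ.∣ i ∣ ℤ.* + suc n
      i≤∣i∣*n (+ k) n = subst₂ ℤ._≤_ (ℤ.pos-* k 1) (ℤ.pos-* k (suc n))
        (ℤ.+≤+ (ℕ.*-monoʳ-≤ k (s≤s z≤n)))
      i≤∣i∣*n ℤ.-[1+ k ] n = ℤ.-≤+
      le : ∀ A → ℚ.toℚᵘ A ℚᵘ.≤ ℚᵘ.mkℚᵘ (+ ℤ.∣ ℚ.↥ A ∣) 0
      le (mkℚ i n _) = ℚᵘ.*≤* (i≤∣i∣*n i n)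

    above : P (+ D)
    above (ε , 0<ε , M , lt) = ℚ.<-irrefl refl (begin-strict
      (+ D / 1)      ≡⟨ ℚ.+-identityʳ (+ D / 1) ⟨
      (+ D / 1) + 0ℚ <⟨ ℚ.+-monoʳ-< (+ D / 1) 0<ε ⟩
      (+ D / 1) + ε  ≤⟨ lt k (ℕ.m≤n⊔m N M) ⟩
      seq x k        ≤⟨ p≤∣p∣ (seq x k) ⟩
      ∣ seq x k ∣    ≤⟨ x≤A k (ℕ.m≤m⊔n N M) ⟩
      A              ≤⟨ A≤D ⟩
      (+ D / 1)      ∎)
      where
      open ℚ.≤-Reasoning
      k = N ℕ.⊔ M

    step-below : (ℤ.- + suc D / 1) + 1ℚ ≡ ℚ.- (+ D / 1)
    step-below = trans (cong (λ z → ℚ.- z + 1ℚ) (/-suc D 0)) (-[a+b]+b≡-a (+ D / 1) 1ℚ)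

    -D≤x : ∀ n → N ℕ.≤ n → ℚ.- (+ D / 1) ℚ.≤ seq x n
    -D≤x n N≤n = ℚ.≤-trans (ℚ.neg-antimono-≤ (ℚ.≤-trans (x≤A n N≤n) A≤D)) (-∣p∣≤p (seq x n))

    below : ¬ P (ℤ.- + suc D)
    below ¬lt = ¬lt (1ℚ , 0<1 , N , λ n N≤n →
      subst (ℚ._≤ seq x n) (sym step-below) (-D≤x n N≤n))

    top : ℤ.- + suc D ℤ.+ + (suc D ℕ.+ D) ≡ + D
    top = trans (cong (λ z → ℤ.- + suc D ℤ.+ z) (ℤ.pos-+ (suc D) D)) (ring (+ suc D) (+ D))
      where
      ring : ∀ a b → ℤ.- a ℤ.+ (a ℤ.+ b) ≡ b
      ring = solveℤ

    search : ∀ k e → ¬ P e → P (e ℤ.+ + k) → ¬ ¬ (∃[ c ] c ≡⌈ x ⌉)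
    search zero e ¬Pe Pe+k none = ¬Pe (subst P (ℤ.+-identityʳ e) Pe+k)
    search (suc k) e ¬Pe Pe+k none = none (e ℤ.+ + suc k , Pe+k , least)
      where
      step : ℤ.suc (e ℤ.+ + k) ≡ e ℤ.+ + suc k
      step = ring e (+ k)
        where
        ring : ∀ a b → + 1 ℤ.+ (a ℤ.+ b) ≡ a ℤ.+ (+ 1 ℤ.+ b)
        ring = solveℤ
      least : ∀ d → P d → e ℤ.+ + suc k ℤ.≤ d
      least d Pd with e ℤ.+ + suc k ℤ.≤? d
      ... | yes le = le
      ... | no ¬le = ⊥-elim (search k e ¬Pe (mono d≤e+k Pd) none)
        where
        d≤e+k : d ℤ.≤ e ℤ.+ + k
        d≤e+k = subst (d ℤ.≤_) (trans (cong ℤ.pred (sym step)) (ℤ.pred-suc (e ℤ.+ + k)))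
          (ℤ.i<j⇒i≤pred[j] (ℤ.≰⇒> ¬le))

⌈⌉-¬¬exists : ∀ x → ¬ ¬ (∃[ c ] c ≡⌈ x ⌉)
⌈⌉-¬¬exists x =
  let A , _ , N , x≤A = eventually-bounded {seq x} (cauchy x)
      open Search x A N x≤A
  in search (suc D ℕ.+ D) (ℤ.- + suc D) below (subst P (sym top) above)

{-# OPTIONS --safe #-}

-- Write p = P + 1, q = P + a + 2 and r = q + w.  Since q - 1 divides n - 1,
-- it divides a + 1 + a w, so P ≤ a w and z = 2 a + w satisfies z² ≥ 8 P.
-- This gives n ≥ P³ + (z + 6) P² + (3 z + 10) P + 2 z + 5.
--
-- If the bound failed, t = n^(1/6) would satisfy t² ≤ P + κ t with
-- κ = 4√3/9, hence also with κ = 8/9.  From z² ≥ 8 P and t ≥ 1 one gets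
-- 8 t ≤ 3 z + 10, and expanding n = t⁶ ≤ (P + κ t)³ by means of
-- (κ t)² ≤ κ² (P + κ t) contradicts the lower bound for n.
--
-- All of this is done in ℕ on the truncations g = ⌊K n^(1/6)⌋ and
-- y = ⌊K n^(1/3)⌋ + 1, where g² ≤ K y; the slack between κ = 7/9
-- (from √3 ≤ 7/4) and κ = 8/9 absorbs the truncation errors once K ≥ 17.
module Submission where

open import Defs
open import Algebra.Properties.Group using (//-rightDividesʳ)
open import Data.Integer using (ℤ; +_; _≤_)
import Data.Integer as ℤ
import Data.Integer.Properties as ℤ
open import Data.Nat
  using (ℕ; NonZero; >-nonZero; zero; suc; s≤s; z≤n; _+_; _*_; _^_; _∸_; _<_)
  renaming (_≤_ to _≤ⁿ_)
import Data.Nat.Properties as Nat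
open import Data.Nat.Divisibility
  using (_∣_; ∣⇒≤; ∣m+n∣m⇒∣n; m∣m*n)
open import Data.Nat.Tactic.RingSolver using (solve-∀)
open import Data.Product using (∃-syntax; _×_; _,_)
open import Data.Rational using (_/_)
import Data.Rational as ℚ
import Data.Rational.Properties as ℚ
open import Data.Rational.Unnormalised using (mkℚᵘ)
import Data.Rational.Unnormalised as ℚᵘ
import Data.Rational.Unnormalised.Properties as ℚᵘ
open import Data.Sum using (inj₁; inj₂)
open import Relation.Binary.PropositionalEquality
open import Relation.Nullary using (¬_)

open Nat.≤-Reasoning

-- Gaps between the three factors

product : (P a w : ℕ) → ℕ
product P a w = (1 + P) * (2 + P + a) * (2 + P + a + w)

-- Modulo Q = 1 + P + a, the product (P+1)(Q+1)(Q+1+w) - 1 is congruent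
-- to -(a + 1 + a w).
divides⇒≤ : ∀ P a w n → n ≡ product P a w →
  (1 + P + a) ∣ (n ∸ 1) → P ≤ⁿ a * w
divides⇒≤ P a w zero ()
divides⇒≤ P a w (suc m) n≡ Q∣m =
  Nat.+-cancelʳ-≤ (1 + a) P (a * w) (begin
    P + (1 + a)      ≡⟨ Nat.+-suc P a ⟩
    1 + P + a        ≤⟨ ∣⇒≤ (∣m+n∣m⇒∣n (subst (1 + P + a ∣_) (sym multiple) (m∣m*n _)) Q∣m) ⟩
    suc (a + a * w)  ≡⟨ Nat.+-comm (1 + a) (a * w) ⟩
    a * w + (1 + a)  ∎)
  where
  ring : ∀ P a w → suc P * (2 + P + a) * (2 + P + a + w) + (a + a * w)
    ≡ (1 + P + a) * (suc P * (2 + P + a + w) + suc P + (1 + w))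
  ring = solve-∀
  multiple : m + suc (a + a * w)
    ≡ (1 + P + a) * (suc P * (2 + P + a + w) + suc P + (1 + w))
  multiple = trans (Nat.+-suc m (a + a * w))
    (trans (cong (_+ (a + a * w)) n≡) (ring P a w))

gaps : ∀ {n p q r} → IsK₃N n p q r →
  ∃[ P ] ∃[ a ] ∃[ w ] p ≡ suc P × 0 < a × P ≤ⁿ a * w ×
    n ≡ product P a w
gaps {n} isK with Nat.m≤n⇒∃[o]m+o≡n (IsK₃N.1<p isK)
  | Nat.m≤n⇒∃[o]m+o≡n (IsK₃N.p<q isK) | Nat.m≤n⇒∃[o]m+o≡n (IsK₃N.q<r isK)
-- The strict inequalities read p = o + 2, q = p + 1 + a and r = q + 1 + b, hence P = o + 1 and w =
-- b + 1.
... | o , refl | a , refl | b , refl =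
  P , a , suc b , refl , 0<a a P≤aw , P≤aw , n≡
  where
  P : ℕ
  P = suc o

  n≡ : n ≡ product P a (suc b)
  n≡ = trans (IsK₃N.n≡pqr isK) (ring P a b)
    where
    ring : ∀ P a b → suc P * (suc (suc P) + a) * (suc (suc (suc P) + a) + b)
      ≡ suc P * (2 + P + a) * (2 + P + a + suc b)
    ring = solve-∀

  P≤aw : P ≤ⁿ a * suc b
  P≤aw = divides⇒≤ P a (suc b) n n≡ (IsK₃N.q-1∣n-1 isK)

  -- For a = 0 the bound would force P ≤ 0, but P = o + 1.
  0<a : ∀ a → P ≤ⁿ a * suc b → 0 < a
  0<a (suc _) _ = s≤s z≤n

-- A bound on the sixth root of n

-- The two sides differ by the square of x - y; ordering x and y first makes that difference a
-- natural number `d`. With x = 2 a and y = w this yields z² ≥ 8 P.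
4xy≤[x+y]² : ∀ x y → 4 * (x * y) ≤ⁿ (x + y) * (x + y)
4xy≤[x+y]² x y with Nat.≤-total x y
... | inj₁ x≤y with Nat.m≤n⇒∃[o]m+o≡n x≤y
...   | d , refl = subst (4 * (x * (x + d)) ≤ⁿ_) (ring x d) (Nat.m≤m+n _ (d * d))
  where
  ring : ∀ x d → 4 * (x * (x + d)) + d * d ≡ (x + (x + d)) * (x + (x + d))
  ring = solve-∀
4xy≤[x+y]² x y | inj₂ y≤x with Nat.m≤n⇒∃[o]m+o≡n y≤x
...   | d , refl = subst (4 * ((y + d) * y) ≤ⁿ_) (ring y d) (Nat.m≤m+n _ (d * d))
  where
  ring : ∀ y d → 4 * ((y + d) * y) + d * d ≡ (y + d + y) * (y + d + y)
  ring = solve-∀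

-- Write A = P K, Z = z K and g = t K. Failure means 8 t - 10 > 3 z. Squaring this and using 9 z² ≥
-- 72 P ≥ 72 t² - 64 t leaves 8 t² + 96 t < 100, which is false for t ≥ 1.
sixth-root-bound : ∀ A Z K g → 8 * (A * K) ≤ⁿ Z * Z → 9 * (g * g) ≤ⁿ (9 * A + 8 * g) * K →
  K ≤ⁿ g → 8 * g ≤ⁿ 3 * Z + 10 * K
sixth-root-bound A Z K g 8AK≤Z² 9g²≤ K≤g = Nat.≮⇒≥ λ lt → impossible (Nat.m≤n⇒∃[o]m+o≡n lt)
  where
  -- The square of 8 g - 10 K = 3 Z + 1 + e, with the mixed term 160 g K moved to the left to avoid
  -- subtraction.
  square : ∀ Z K g e → suc (3 * Z + 10 * K) + e ≡ 8 * g →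
    suc (9 * (Z * Z)) + 160 * (g * K) ≤ⁿ 64 * (g * g) + 100 * (K * K)
  square Z K g e eq = begin
    suc (9 * (Z * Z)) + 160 * (g * K)                       ≡⟨ ring₁ Z K g ⟩
    suc (9 * (Z * Z)) + 20 * ((8 * g) * K)                  ≡⟨ cong (λ z → suc (9 * (Z * Z)) + 20 * (z * K)) eq ⟨
    suc (9 * (Z * Z)) + 20 * ((suc (3 * Z + 10 * K) + e) * K)
      ≤⟨ Nat.m≤m+n _ (6 * Z + 2 * e + 6 * (Z * e) + e * e) ⟩
    suc (9 * (Z * Z)) + 20 * ((suc (3 * Z + 10 * K) + e) * K) + (6 * Z + 2 * e + 6 * (Z * e) + e * e)
      ≡⟨ ring₂ Z K e ⟩
    (suc (3 * Z + 10 * K) + e) * (suc (3 * Z + 10 * K) + e) + 100 * (K * K)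
      ≡⟨ cong (λ z → z * z + 100 * (K * K)) eq ⟩
    (8 * g) * (8 * g) + 100 * (K * K)                       ≡⟨ ring₃ K g ⟩
    64 * (g * g) + 100 * (K * K)                            ∎
    where
    ring₁ : ∀ Z K g → suc (9 * (Z * Z)) + 160 * (g * K) ≡ suc (9 * (Z * Z)) + 20 * ((8 * g) * K)
    ring₁ = solve-∀
    ring₂ : ∀ Z K e → suc (9 * (Z * Z)) + 20 * ((suc (3 * Z + 10 * K) + e) * K) + (6 * Z + 2 * e + 6 * (Z * e) + e * e)
      ≡ (suc (3 * Z + 10 * K) + e) * (suc (3 * Z + 10 * K) + e) + 100 * (K * K)
    ring₂ = solve-∀
    ring₃ : ∀ K g → (8 * g) * (8 * g) + 100 * (K * K) ≡ 64 * (g * g) + 100 * (K * K)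
    ring₃ = solve-∀

  impossible : ¬ (∃[ e ] suc (3 * Z + 10 * K) + e ≡ 8 * g)
  impossible (e , eq) = Nat.<-irrefl refl (begin-strict
    72 * (g * g) + 160 * (g * K)                              ≡⟨ ring₁ g K ⟩
    8 * (9 * (g * g)) + 160 * (g * K)                         ≤⟨ Nat.+-monoˡ-≤ _ (Nat.*-monoʳ-≤ 8 9g²≤) ⟩
    8 * ((9 * A + 8 * g) * K) + 160 * (g * K)                 ≡⟨ ring₂ A g K ⟩
    9 * (8 * (A * K)) + 160 * (g * K) + 64 * (g * K)          ≤⟨ Nat.+-monoˡ-≤ _ (Nat.+-monoˡ-≤ _ (Nat.*-monoʳ-≤ 9 8AK≤Z²)) ⟩
    9 * (Z * Z) + 160 * (g * K) + 64 * (g * K)                <⟨ Nat.n<1+n _ ⟩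
    suc (9 * (Z * Z)) + 160 * (g * K) + 64 * (g * K)          ≤⟨ Nat.+-monoˡ-≤ _ (square Z K g e eq) ⟩
    64 * (g * g) + 100 * (K * K) + 64 * (g * K)               ≡⟨ ring₃ g K ⟩
    64 * (g * g) + 64 * (g * K) + 96 * (K * K) + 4 * (K * K)
      ≤⟨ Nat.+-mono-≤ (Nat.+-monoʳ-≤ (64 * (g * g) + 64 * (g * K)) (Nat.*-monoʳ-≤ 96 (Nat.*-monoˡ-≤ K K≤g)))
           (Nat.*-mono-≤ (Nat.m≤m+n 4 4) (Nat.*-mono-≤ K≤g K≤g)) ⟩
    64 * (g * g) + 64 * (g * K) + 96 * (g * K) + 8 * (g * g)  ≡⟨ ring₄ g K ⟩
    72 * (g * g) + 160 * (g * K)                              ∎)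
    where
    ring₁ : ∀ g K → 72 * (g * g) + 160 * (g * K) ≡ 8 * (9 * (g * g)) + 160 * (g * K)
    ring₁ = solve-∀
    ring₂ : ∀ A g K → 8 * ((9 * A + 8 * g) * K) + 160 * (g * K)
      ≡ 9 * (8 * (A * K)) + 160 * (g * K) + 64 * (g * K)
    ring₂ = solve-∀
    ring₃ : ∀ g K → 64 * (g * g) + 100 * (K * K) + 64 * (g * K)
      ≡ 64 * (g * g) + 64 * (g * K) + 96 * (K * K) + 4 * (K * K)
    ring₃ = solve-∀
    ring₄ : ∀ g K → 64 * (g * g) + 64 * (g * K) + 96 * (g * K) + 8 * (g * g)
      ≡ 72 * (g * g) + 160 * (g * K)
    ring₄ = solve-∀

-- Comparison of cubes

-- The hypothesis eliminates v² twice: first where 3 X + v multiplies it, then in the remaining M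
-- v². The result is linear in `v` and ordered by powers of `X`, like `lower-cubic`.
cube-expand : ∀ X v M → v * v ≤ⁿ M * (X + v) →
  (X + v) * (X + v) * (X + v) ≤ⁿ
    X * X * X + X * X * (3 * (v + M)) + X * (M * (4 * v + M)) + M * M * v
cube-expand X v M v²≤ = begin
  (X + v) * (X + v) * (X + v)
    ≡⟨ ring₁ X v ⟩
  X * X * X + 3 * (X * X * v) + (3 * X + v) * (v * v)
    ≤⟨ Nat.+-monoʳ-≤ (X * X * X + 3 * (X * X * v)) (Nat.*-monoʳ-≤ (3 * X + v) v²≤) ⟩
  X * X * X + 3 * (X * X * v) + (3 * X + v) * (M * (X + v))
    ≡⟨ ring₂ X v M ⟩
  X * X * X + X * X * (3 * (v + M)) + 4 * (M * X * v) + M * (v * v)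
    ≤⟨ Nat.+-monoʳ-≤ (X * X * X + X * X * (3 * (v + M)) + 4 * (M * X * v))
         (Nat.*-monoʳ-≤ M v²≤) ⟩
  X * X * X + X * X * (3 * (v + M)) + 4 * (M * X * v) + M * (M * (X + v))
    ≡⟨ ring₃ X v M ⟩
  X * X * X + X * X * (3 * (v + M)) + X * (M * (4 * v + M)) + M * M * v ∎
  where
  ring₁ : ∀ X v → (X + v) * (X + v) * (X + v)
    ≡ X * X * X + 3 * (X * X * v) + (3 * X + v) * (v * v)
  ring₁ = solve-∀
  ring₂ : ∀ X v M → X * X * X + 3 * (X * X * v) + (3 * X + v) * (M * (X + v))
    ≡ X * X * X + X * X * (3 * (v + M)) + 4 * (M * X * v) + M * (v * v)
  ring₂ = solve-∀
  ring₃ : ∀ X v M →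
    X * X * X + X * X * (3 * (v + M)) + 4 * (M * X * v) + M * (M * (X + v))
    ≡ X * X * X + X * X * (3 * (v + M)) + X * (M * (4 * v + M)) + M * M * v
  ring₃ = solve-∀

-- K³ times the lower bound for n, at A = K P and Z = K z
lower-cubic : (A Z K : ℕ) → ℕ
lower-cubic A Z K =
  A * A * A + A * A * (Z + 6 * K) + A * (K * (3 * Z + 10 * K)) + K * K * (2 * Z + 5 * K)

-- The bound of `cube-expand` is compared with `lower-cubic` coefficient by coefficient. The
-- estimate for X² is assumed; those for 4 v + M and v follow from it, multiplied by 3 to stay in ℕ.
cube-bound : ∀ X Z L v M → M ≤ⁿ L → 3 * (v + M) ≤ⁿ Z + 6 * L → v * v ≤ⁿ M * (X + v) →
  (X + v) * (X + v) * (X + v) ≤ⁿ lower-cubic X Z L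
cube-bound X Z L v M M≤L 3[v+M]≤ v²≤ = Nat.≤-trans (cube-expand X v M v²≤)
  (Nat.+-mono-≤
    (Nat.+-mono-≤
      (Nat.+-monoʳ-≤ (X * X * X) (Nat.*-monoʳ-≤ (X * X) 3[v+M]≤))
      (Nat.*-monoʳ-≤ X (Nat.*-mono-≤ M≤L 4v+M≤)))
    (Nat.*-mono-≤ (Nat.*-mono-≤ M≤L M≤L) v≤))
  where
  4v+M≤ : 4 * v + M ≤ⁿ 3 * Z + 10 * L
  4v+M≤ = Nat.*-cancelˡ-≤ 3 (begin
    3 * (4 * v + M)                                 ≤⟨ Nat.m≤m+n _ (9 * M) ⟩
    3 * (4 * v + M) + 9 * M                         ≡⟨ ring₁ v M ⟩
    4 * (3 * (v + M))                               ≤⟨ Nat.*-monoʳ-≤ 4 3[v+M]≤ ⟩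
    4 * (Z + 6 * L)                                 ≤⟨ Nat.m≤m+n _ (5 * Z + 6 * L) ⟩
    4 * (Z + 6 * L) + (5 * Z + 6 * L)               ≡⟨ ring₂ Z L ⟩
    3 * (3 * Z + 10 * L)                            ∎)
    where
    ring₁ : ∀ v M → 3 * (4 * v + M) + 9 * M ≡ 4 * (3 * (v + M))
    ring₁ = solve-∀
    ring₂ : ∀ Z L → 4 * (Z + 6 * L) + (5 * Z + 6 * L) ≡ 3 * (3 * Z + 10 * L)
    ring₂ = solve-∀
  v≤ : v ≤ⁿ 2 * Z + 5 * L
  v≤ = Nat.*-cancelˡ-≤ 3 (begin
    3 * v                            ≤⟨ Nat.*-monoʳ-≤ 3 (Nat.m≤m+n v M) ⟩
    3 * (v + M)                      ≤⟨ 3[v+M]≤ ⟩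
    Z + 6 * L                        ≤⟨ Nat.m≤m+n _ (5 * Z + 9 * L) ⟩
    Z + 6 * L + (5 * Z + 9 * L)      ≡⟨ ring Z L ⟩
    3 * (2 * Z + 5 * L)              ∎)
    where
    ring : ∀ Z L → Z + 6 * L + (5 * Z + 9 * L) ≡ 3 * (2 * Z + 5 * L)
    ring = solve-∀

-- With z = 2 a + w, (P + a + 2) (P + a + w + 2) equals P² + (z + 4) P + 2 z + 4 + a² + a w.
-- Replacing a² by 1 and a w by P leaves an expression in P and z alone.
lower-cubic≤ : ∀ P a w K → 0 < a → P ≤ⁿ a * w →
  lower-cubic (P * K) ((2 * a + w) * K) K ≤ⁿ product P a w * (K * K * K)
lower-cubic≤ P a w K 0<a P≤aw = begin
  lower-cubic (P * K) ((2 * a + w) * K) K ≡⟨ ring₁ P a w K ⟩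
  (1 + P) * (P * P + P * (4 + (2 * a + w)) + (4 + 2 * (2 * a + w) + 1 * 1 + P)) * (K * K * K)
    ≤⟨ Nat.*-monoˡ-≤ (K * K * K) (Nat.*-monoʳ-≤ (1 + P)
         (Nat.+-monoʳ-≤ (P * P + P * (4 + (2 * a + w)))
           (Nat.+-mono-≤ (Nat.+-monoʳ-≤ (4 + 2 * (2 * a + w)) (Nat.*-mono-≤ 0<a 0<a)) P≤aw))) ⟩
  (1 + P) * (P * P + P * (4 + (2 * a + w)) + (4 + 2 * (2 * a + w) + a * a + a * w)) * (K * K * K)
    ≡⟨ ring₂ P a w K ⟩
  product P a w * (K * K * K) ∎
  where
  ring₁ : ∀ P a w K →
    P * K * (P * K) * (P * K) + P * K * (P * K) * ((2 * a + w) * K + 6 * K)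
      + P * K * (K * (3 * ((2 * a + w) * K) + 10 * K))
      + K * K * (2 * ((2 * a + w) * K) + 5 * K)
    ≡ (1 + P) * (P * P + P * (4 + (2 * a + w)) + (4 + 2 * (2 * a + w) + 1 * 1 + P)) * (K * K * K)
  ring₁ = solve-∀
  ring₂ : ∀ P a w K →
    (1 + P) * (P * P + P * (4 + (2 * a + w)) + (4 + 2 * (2 * a + w) + a * a + a * w)) * (K * K * K)
    ≡ (1 + P) * (2 + P + a) * (2 + P + a + w) * (K * K * K)
  ring₂ = solve-∀

-- cube-bound is applied at scale 81 K, where v = (8/9) (81 g) and
-- M = (8/9)² (81 K) are integers.
cube≤ : ∀ P a w K g y → 0 < a → P ≤ⁿ a * w → K ≤ⁿ g → g * g ≤ⁿ y * K →
  9 * y ≤ⁿ 9 * (P * K) + 8 * g → y * y * y ≤ⁿ product P a w * (K * K * K)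
cube≤ P a w K g y 0<a P≤aw K≤g g²≤yK 9y≤ =
  unscale 80 y K (begin
    81 * y * (81 * y) * (81 * y)         ≤⟨ Nat.*-mono-≤ (Nat.*-mono-≤ 81y≤ 81y≤) 81y≤ ⟩
    (X + v) * (X + v) * (X + v)          ≤⟨ cube-bound X ((2 * a + w) * L) L v (64 * K) (Nat.*-monoˡ-≤ K (Nat.m≤m+n 64 17)) 3[v+M]≤ v²≤ ⟩
    lower-cubic X ((2 * a + w) * L) L    ≤⟨ lower-cubic≤ P a w L 0<a P≤aw ⟩
    product P a w * (L * L * L)           ∎)
  where
  Z L X v : ℕ
  Z = (2 * a + w) * K
  L = 81 * K
  X = P * L
  v = 9 * (8 * g)

  unscale : ∀ c y K → suc c * y * (suc c * y) * (suc c * y)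
      ≤ⁿ product P a w * (suc c * K * (suc c * K) * (suc c * K)) →
    y * y * y ≤ⁿ product P a w * (K * K * K)
  unscale c y K le = Nat.*-cancelˡ-≤ (suc c * suc c * suc c)
    (subst₂ _≤ⁿ_ (ring₁ (suc c) y) (ring₂ (suc c) (product P a w) K) le)
    where
    ring₁ : ∀ c y → c * y * (c * y) * (c * y) ≡ c * c * c * (y * y * y)
    ring₁ = solve-∀
    ring₂ : ∀ c H K → H * (c * K * (c * K) * (c * K)) ≡ c * c * c * (H * (K * K * K))
    ring₂ = solve-∀

  9g²≤ : 9 * (g * g) ≤ⁿ (9 * (P * K) + 8 * g) * K
  9g²≤ = begin
    9 * (g * g)                      ≤⟨ Nat.*-monoʳ-≤ 9 g²≤yK ⟩
    9 * (y * K)                      ≡⟨ Nat.*-assoc 9 y K ⟨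
    9 * y * K                        ≤⟨ Nat.*-monoˡ-≤ K 9y≤ ⟩
    (9 * (P * K) + 8 * g) * K        ∎

  8PK²≤Z² : 8 * (P * K * K) ≤ⁿ Z * Z
  8PK²≤Z² = begin
    8 * (P * K * K)                            ≡⟨ ring₁ P K ⟩
    8 * P * (K * K)                            ≤⟨ Nat.*-monoˡ-≤ (K * K) (Nat.*-monoʳ-≤ 8 P≤aw) ⟩
    8 * (a * w) * (K * K)                      ≡⟨ ring₂ a w K ⟩
    4 * (2 * a * w) * (K * K)                  ≤⟨ Nat.*-monoˡ-≤ (K * K) (4xy≤[x+y]² (2 * a) w) ⟩
    (2 * a + w) * (2 * a + w) * (K * K)        ≡⟨ ring₃ (2 * a + w) K ⟩
    Z * Z                                      ∎
    where
    ring₁ : ∀ P K → 8 * (P * K * K) ≡ 8 * P * (K * K)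
    ring₁ = solve-∀
    ring₂ : ∀ a w K → 8 * (a * w) * (K * K) ≡ 4 * (2 * a * w) * (K * K)
    ring₂ = solve-∀
    ring₃ : ∀ z K → z * z * (K * K) ≡ z * K * (z * K)
    ring₃ = solve-∀

  8g≤ : 8 * g ≤ⁿ 3 * Z + 10 * K
  8g≤ = sixth-root-bound (P * K) Z K g 8PK²≤Z² 9g²≤ K≤g

  81y≤ : 81 * y ≤ⁿ X + v
  81y≤ = begin
    81 * y                           ≡⟨ Nat.*-assoc 9 9 y ⟩
    9 * (9 * y)                      ≤⟨ Nat.*-monoʳ-≤ 9 9y≤ ⟩
    9 * (9 * (P * K) + 8 * g)        ≡⟨ ring P K g ⟩
    X + v                            ∎
    where
    ring : ∀ P K g → 9 * (9 * (P * K) + 8 * g) ≡ P * (81 * K) + 9 * (8 * g)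
    ring = solve-∀

  -- This is 3 (κ t + κ²) ≤ z + 6 for κ = 8/9: from 8 t ≤ 3 z + 10 the left side is at most z + 10/3
  -- + 64/27, and 154/27 < 6.
  3[v+M]≤ : 3 * (v + 64 * K) ≤ⁿ (2 * a + w) * L + 6 * L
  3[v+M]≤ = begin
    3 * (9 * (8 * g) + 64 * K)
      ≤⟨ Nat.*-monoʳ-≤ 3 (Nat.+-monoˡ-≤ (64 * K) (Nat.*-monoʳ-≤ 9 8g≤)) ⟩
    3 * (9 * (3 * Z + 10 * K) + 64 * K)
      ≤⟨ Nat.m≤m+n _ (24 * K) ⟩
    3 * (9 * (3 * Z + 10 * K) + 64 * K) + 24 * K
      ≡⟨ ring (2 * a + w) K ⟩
    (2 * a + w) * L + 6 * L ∎
    where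
    ring : ∀ z K → 3 * (9 * (3 * (z * K) + 10 * K) + 64 * K) + 24 * K
      ≡ z * (81 * K) + 6 * (81 * K)
    ring = solve-∀

  v²≤ : v * v ≤ⁿ 64 * K * (X + v)
  v²≤ = begin
    9 * (8 * g) * (9 * (8 * g))              ≡⟨ ring₁ g ⟩
    64 * (9 * (9 * (g * g)))                 ≤⟨ Nat.*-monoʳ-≤ 64 (Nat.*-monoʳ-≤ 9 9g²≤) ⟩
    64 * (9 * ((9 * (P * K) + 8 * g) * K))   ≡⟨ ring₂ P K g ⟩
    64 * K * (X + v)                         ∎
    where
    ring₁ : ∀ g → 9 * (8 * g) * (9 * (8 * g)) ≡ 64 * (9 * (9 * (g * g)))
    ring₁ = solve-∀
    ring₂ : ∀ P K g → 64 * (9 * ((9 * (P * K) + 8 * g) * K)) ≡ 64 * K * (P * (81 * K) + 9 * (8 * g))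
    ring₂ = solve-∀

-- Truncated roots

-- Divided by 18 K, the claim is P + 1/18 + (7/9) n^(1/6) ≤ n^(1/3) for the truncated roots. Its
-- failure would let `cube≤` bound y³ by n K³, although y exceeds the cube root of n K³.
root-gap : ∀ {n} P a w K → n ≡ product P a w → 0 < a → P ≤ⁿ a * w → 17 ≤ⁿ K →
  18 * (P * K) + K + 14 * ⌊root⌋ 6 (n * K ^ 6) ≤ⁿ 18 * ⌊root⌋ 3 (n * K ^ 3)
root-gap {n} P a w K n≡ 0<a P≤aw 17≤K = Nat.≮⇒≥ λ lt → Nat.<⇒≱ nK³<y³ (begin
  y ^ 3                             ≡⟨ ring₁ y ⟩
  y * y * y                         ≤⟨ cube≤ P a w K g y 0<a P≤aw K≤g g²≤yK (9y≤ lt) ⟩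
  product P a w * (K * K * K)        ≡⟨ cong₂ _*_ n≡ (ring₁ K) ⟨
  n * K ^ 3                         ∎)
  where
  g f y : ℕ
  g = ⌊root⌋ 6 (n * K ^ 6)
  f = ⌊root⌋ 3 (n * K ^ 3)
  y = suc f

  ring₁ : ∀ y → y * (y * (y * 1)) ≡ y * y * y
  ring₁ = solve-∀

  nK³<y³ : n * K ^ 3 < y ^ 3
  nK³<y³ = ⌊root⌋-upper 3 (n * K ^ 3)

  K≤g : K ≤ⁿ g
  K≤g = Nat.≮⇒≥ λ g<K → Nat.<⇒≱ (⌊root⌋-upper 6 (n * K ^ 6)) (begin
    suc g ^ 6        ≤⟨ Nat.^-monoˡ-≤ 6 g<K ⟩
    K ^ 6            ≡⟨ Nat.*-identityˡ (K ^ 6) ⟨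
    1 * K ^ 6        ≤⟨ Nat.*-monoˡ-≤ (K ^ 6) (subst (0 <_) (sym n≡) (s≤s z≤n)) ⟩
    n * K ^ 6        ∎)

  K>0 : NonZero (K ^ 3)
  K>0 = Nat.m^n≢0 K 3 {{>-nonZero (Nat.≤-trans (s≤s z≤n) 17≤K)}}

  -- Cubes are compared: (g²)³ ≤ n K⁶ < (y K)³. Rounding up to y supplies the upper bound on n that
  -- f lacks.
  g²≤yK : g * g ≤ⁿ y * K
  g²≤yK = Nat.≮⇒≥ λ yK<g² → Nat.<-irrefl refl (begin-strict
    n * K ^ 3 * K ^ 3                <⟨ Nat.*-monoˡ-< (K ^ 3) {{K>0}} nK³<y³ ⟩
    y ^ 3 * K ^ 3                    ≡⟨ ring₃ y K ⟩
    (y * K) ^ 3                      ≤⟨ Nat.^-monoˡ-≤ 3 (Nat.<⇒≤ yK<g²) ⟩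
    (g * g) ^ 3                      ≡⟨ ring₂ g ⟩
    g ^ 6                            ≤⟨ ⌊root⌋-lower 6 (n * K ^ 6) ⟩
    n * K ^ 6                        ≡⟨ cong (n *_) (Nat.^-distribˡ-+-* K 3 3) ⟩
    n * (K ^ 3 * K ^ 3)              ≡⟨ Nat.*-assoc n (K ^ 3) (K ^ 3) ⟨
    n * K ^ 3 * K ^ 3                ∎)
    where
    ring₂ : ∀ g → g * g * (g * g * (g * g * 1)) ≡ g * (g * (g * (g * (g * (g * 1)))))
    ring₂ = solve-∀
    ring₃ : ∀ y K → y * (y * (y * 1)) * (K * (K * (K * 1)))
      ≡ y * K * (y * K * (y * K * 1))
    ring₃ = solve-∀

  9y≤ : 18 * f < 18 * (P * K) + K + 14 * g → 9 * y ≤ⁿ 9 * (P * K) + 8 * g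
  9y≤ lt = Nat.*-cancelˡ-≤ 2 (begin
    2 * (9 * y)                                ≡⟨ ring₃ f ⟩
    -- Of the 16 g available for κ = 8/9, 14 g belongs to κ = 7/9; the other 2 g absorb the margin
    -- `K` and the 17 left from rounding f up, since 17 ≤ K ≤ g.
    suc (18 * f) + 17                          ≤⟨ Nat.+-mono-≤ lt 17≤K ⟩
    18 * (P * K) + K + 14 * g + K              ≤⟨ Nat.+-mono-≤ (Nat.+-monoˡ-≤ (14 * g) (Nat.+-monoʳ-≤ (18 * (P * K)) K≤g)) K≤g ⟩
    18 * (P * K) + g + 14 * g + g              ≡⟨ ring₄ (P * K) g ⟩
    2 * (9 * (P * K) + 8 * g)                  ∎)
    where
    ring₃ : ∀ f → 2 * (9 * suc f) ≡ suc (18 * f) + 17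
    ring₃ = solve-∀
    ring₄ : ∀ x g → 18 * x + g + 14 * g + g ≡ 2 * (9 * x + 8 * g)
    ring₄ = solve-∀

-- 3 is passed as a variable m: ⌊root⌋ would unfold on a literal.
√3≤7/4 : ∀ {m} K → m ≡ 3 → 4 * ⌊root⌋ 2 (m * K ^ 2) ≤ⁿ 7 * K
√3≤7/4 {m} K m≡3 = Nat.≮⇒≥ λ lt → Nat.<-irrefl refl (begin-strict
  7 * K * (7 * K)               <⟨ Nat.*-mono-< lt lt ⟩
  4 * h * (4 * h)               ≡⟨ ring₁ h ⟩
  16 * h ^ 2                    ≤⟨ Nat.*-monoʳ-≤ 16 (⌊root⌋-lower 2 (m * K ^ 2)) ⟩
  16 * (m * K ^ 2)              ≡⟨ cong (λ z → 16 * (z * K ^ 2)) m≡3 ⟩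
  16 * (3 * K ^ 2)              ≤⟨ Nat.m≤m+n _ (K * K) ⟩
  16 * (3 * K ^ 2) + K * K      ≡⟨ ring₂ K ⟩
  7 * K * (7 * K)               ∎)
  where
  h : ℕ
  h = ⌊root⌋ 2 (m * K ^ 2)
  ring₁ : ∀ h → 4 * h * (4 * h) ≡ 16 * (h * (h * 1))
  ring₁ = solve-∀
  ring₂ : ∀ K → 16 * (3 * (K * (K * 1))) + K * K ≡ 7 * K * (7 * K)
  ring₂ = solve-∀

-- Passage to rational numbers

-- Carries the left side of `fraction≤` to unnormalised fractions, whose order is plain
-- cross-multiplication.
toℚᵘ-homo : ∀ a b c d e {a′ b′ c′ d′ e′} →
  ℚ.toℚᵘ a ℚᵘ.≃ a′ → ℚ.toℚᵘ b ℚᵘ.≃ b′ → ℚ.toℚᵘ c ℚᵘ.≃ c′ →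
  ℚ.toℚᵘ d ℚᵘ.≃ d′ → ℚ.toℚᵘ e ℚᵘ.≃ e′ →
  ℚ.toℚᵘ (a ℚ.+ b ℚ.+ c ℚ.* d ℚ.* e) ℚᵘ.≃ a′ ℚᵘ.+ b′ ℚᵘ.+ c′ ℚᵘ.* d′ ℚᵘ.* e′
toℚᵘ-homo a b c d e a≃ b≃ c≃ d≃ e≃ =
  ℚᵘ.≃-trans (ℚ.toℚᵘ-homo-+ (a ℚ.+ b) (c ℚ.* d ℚ.* e)) (ℚᵘ.+-cong
    (ℚᵘ.≃-trans (ℚ.toℚᵘ-homo-+ a b) (ℚᵘ.+-cong a≃ b≃))
    (ℚᵘ.≃-trans (ℚ.toℚᵘ-homo-* (c ℚ.* d) e)
      (ℚᵘ.*-cong (ℚᵘ.≃-trans (ℚ.toℚᵘ-homo-* c d) (ℚᵘ.*-cong c≃ d≃)) e≃)))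

-- As h / K ≤ 7/4, the factor 4/9 · h / K is at most 7/9; the cleared inequality is then `le`
-- multiplied by 9 K².
fraction≤ : ∀ P f g h k → 4 * h ≤ⁿ 7 * suc k → 18 * (P * suc k) + suc k + 14 * g ≤ⁿ 18 * f →
  (+ P / 1) ℚ.+ (+ 1 / 18) ℚ.+ (+ 4 / 9) ℚ.* (+ h / suc k) ℚ.* (+ g / suc k) ℚ.≤ + f / suc k
fraction≤ P f g h k 4h≤ le = ℚ.toℚᵘ-cancel-≤
  (ℚᵘ.≤-respˡ-≃ (ℚᵘ.≃-sym lhs≃)
    (ℚᵘ.≤-respʳ-≃ (ℚᵘ.≃-sym (ℚ.toℚᵘ-fromℚᵘ (mkℚᵘ (+ f) k))) (ℚᵘ.*≤* integral)))
  where
  K : ℕ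
  K = suc k

  lhs≃ : ℚ.toℚᵘ ((+ P / 1) ℚ.+ (+ 1 / 18) ℚ.+ (+ 4 / 9) ℚ.* (+ h / suc k) ℚ.* (+ g / suc k))
    ℚᵘ.≃ mkℚᵘ (+ P) 0 ℚᵘ.+ mkℚᵘ (+ 1) 17 ℚᵘ.+ mkℚᵘ (+ 4) 8 ℚᵘ.* mkℚᵘ (+ h) k ℚᵘ.* mkℚᵘ (+ g) k
  lhs≃ = toℚᵘ-homo (+ P / 1) (+ 1 / 18) (+ 4 / 9) (+ h / suc k) (+ g / suc k)
    (ℚ.toℚᵘ-fromℚᵘ (mkℚᵘ (+ P) 0)) (ℚ.toℚᵘ-fromℚᵘ (mkℚᵘ (+ 1) 17))
    (ℚ.toℚᵘ-fromℚᵘ (mkℚᵘ (+ 4) 8)) (ℚ.toℚᵘ-fromℚᵘ (mkℚᵘ (+ h) k))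
    (ℚ.toℚᵘ-fromℚᵘ (mkℚᵘ (+ g) k))

  natural : ((P * 18 + 1) * (9 * K * K) + 4 * h * g * 18) * K ≤ⁿ f * (18 * (9 * K * K))
  natural = begin
    ((P * 18 + 1) * (9 * K * K) + 4 * h * g * 18) * K
      ≤⟨ Nat.*-monoˡ-≤ K (Nat.+-monoʳ-≤ ((P * 18 + 1) * (9 * K * K))
           (Nat.*-monoˡ-≤ 18 (Nat.*-monoˡ-≤ g 4h≤))) ⟩
    ((P * 18 + 1) * (9 * K * K) + 7 * K * g * 18) * K
      ≡⟨ ring₁ P g K ⟩
    9 * K * K * (18 * (P * K) + K + 14 * g)
      ≤⟨ Nat.*-monoʳ-≤ (9 * K * K) le ⟩
    9 * K * K * (18 * f)
      ≡⟨ ring₂ f K ⟩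
    f * (18 * (9 * K * K)) ∎
    where
    ring₁ : ∀ P g K → ((P * 18 + 1) * (9 * K * K) + 7 * K * g * 18) * K
      ≡ 9 * K * K * (18 * (P * K) + K + 14 * g)
    ring₁ = solve-∀
    ring₂ : ∀ f K → 9 * K * K * (18 * f) ≡ f * (18 * (9 * K * K))
    ring₂ = solve-∀

  -- The type is what the unnormalised order unfolds to; the rewrites gather the integer products
  -- into images of natural numbers.
  integral : ((+ P ℤ.* + 18 ℤ.+ + 1 ℤ.* + 1) ℤ.* + (9 * K * K) ℤ.+ + 4 ℤ.* + h ℤ.* + g ℤ.* + 18) ℤ.* + K
    ≤ + f ℤ.* + (18 * (9 * K * K))
  integral
    rewrite sym (ℤ.pos-* P 18) | sym (ℤ.pos-* 4 h) | sym (ℤ.pos-* (4 * h) g)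
    | sym (ℤ.pos-* (4 * h * g) 18) | sym (ℤ.pos-* (P * 18 + 1) (9 * K * K))
    | sym (ℤ.pos-* ((P * 18 + 1) * (9 * K * K) + 4 * h * g * 18) K)
    | sym (ℤ.pos-* f (18 * (9 * K * K)))
    = ℤ.+≤+ natural

rootSeq-gap : ∀ {n m} P a w k → n ≡ product P a w → m ≡ 3 → 0 < a → P ≤ⁿ a * w → 16 ≤ⁿ k →
  (+ P / 1) ℚ.+ (+ 1 / 18) ℚ.+ (+ 4 / 9) ℚ.* rootSeq 2 m k ℚ.* rootSeq 6 n k ℚ.≤ rootSeq 3 n k
rootSeq-gap {n} {m} P a w k n≡ m≡3 0<a P≤aw 16≤k =
  fraction≤ P (⌊root⌋ 3 (n * suc k ^ 3)) (⌊root⌋ 6 (n * suc k ^ 6)) (⌊root⌋ 2 (m * suc k ^ 2)) k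
    (√3≤7/4 (suc k) m≡3) (root-gap P a w (suc k) n≡ 0<a P≤aw (s≤s 16≤k))

-- Passage to real numbers

/1-mono-≤ : ∀ {i j} → i ≤ j → i / 1 ℚ.≤ j / 1
/1-mono-≤ {i} {j} i≤j = ℚ.toℚᵘ-cancel-≤
  (ℚᵘ.≤-respˡ-≃ (ℚᵘ.≃-sym (ℚ.toℚᵘ-fromℚᵘ (mkℚᵘ i 0)))
  (ℚᵘ.≤-respʳ-≃ (ℚᵘ.≃-sym (ℚ.toℚᵘ-fromℚᵘ (mkℚᵘ j 0)))
  (ℚᵘ.*≤* (ℤ.*-monoʳ-≤-nonNeg (+ 1) i≤j))))

x+y≤z⇒x≤z-y : ∀ x y z → x ℚ.+ y ℚ.≤ z → x ℚ.≤ z ℚ.- y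
x+y≤z⇒x≤z-y x y z le =
  subst (ℚ._≤ z ℚ.- y) (//-rightDividesʳ ℚ.+-0-group y x) (ℚ.+-monoˡ-≤ (ℚ.- y) le)

<ᴿ-gap : ∀ {n} P a w c → n ≡ product P a w → 0 < a → P ≤ⁿ a * w → c ≤ + P →
  fromℤ c <ᴿ root 3 n -ᴿ fromℚ (+ 4 / 9) *ᴿ root 2 3 *ᴿ root 6 n
<ᴿ-gap {n} P a w c n≡ 0<a P≤aw c≤P =
  -- The margin 1/18 comes from the term `K` in `root-gap`, and indices from 16 on give denominators
  -- of at least 17.
  + 1 / 18 , ℚ.positive⁻¹ (+ 1 / 18) , 16 , λ k 16≤k →
    let y = + 4 / 9 ℚ.* rootSeq 2 3 k ℚ.* rootSeq 6 n k in
    x+y≤z⇒x≤z-y (c / 1 ℚ.+ + 1 / 18) y (rootSeq 3 n k)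
      (ℚ.≤-trans (ℚ.+-monoˡ-≤ y (ℚ.+-monoˡ-≤ (+ 1 / 18) (/1-mono-≤ c≤P)))
        (rootSeq-gap P a w k n≡ refl 0<a P≤aw 16≤k))

theorem4p6 : ∀ {n p q r : ℕ} → IsK₃N n p q r →
    ∀ (c : ℤ) → c ≡⌈ root 3 n -ᴿ fromℚ (+ 4 / 9) *ᴿ root 2 3 *ᴿ root 6 n ⌉ →
    + p ≤ c
theorem4p6 isK c (x≤c , _) =
  let P , a , w , p≡ , 0<a , P≤aw , n≡ = gaps isK in
  -- If c < p = P + 1 then c ≤ P, so c lies strictly below the real number whose ceiling it is.
  ℤ.≮⇒≥ λ c<p → x≤c (<ᴿ-gap P a w c n≡ 0<a P≤aw
    (ℤ.i<j⇒i≤pred[j] (subst (λ z → c ℤ.< + z) p≡ c<p)))
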